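{- If $n\equiv 2\pmod 4$, then the graph $2Q_{n-1}$ is $\left(\frac{n(2^n+1)}{2}-2^n,\,1\right)$-distance antimagic. If $n\equiv 1\pmod 4$, then $2Q_{n-1}$ is $\left(\frac{(n+1)(2^n+1)}{2}-2^n,\,1\right)$-closed distance antimagic.
   Context: $Q_m$ is the $m$-dimensional hypercube (vertex set $\mathbb{F}_2^m$, adjacency iff differing in exactly one coordinate), and $2Q_{n-1}$ is the disjoint union of two copies of $Q_{n-1}$, a graph of order $2^n$. For a graph $G$ of order $N$, a set of distances $D$, and a bijection $f:V(G)\to\{1,\dots,N\}$, the weight of $x$ is $w(x)=\sum_{y\in N_D(x)}f(y)$ where $N_D(x)$ is the set of vertices at distance in $D$ from $x$. $f$ is an $(\alpha,\delta)$-$D$-antimagic labeling if the weights are pairwise distinct and $\{w(x)\}$ forms an arithmetic progression starting at $\alpha$ with difference $\delta>0$; a graph is $(\alpha,\delta)$-distance antimagic (resp. $(\alpha,\delta)$-closed distance antimagic) if it admits such a labeling with $D=\{1\}$ (resp. $D=\{0,1\}$). -}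

module Defs where

open import Data.Bool using (Bool; true; false)
open import Data.Bool.Properties using () renaming (_≟_ to _≟ᵇ_)
open import Data.Empty using (⊥)
open import Data.Fin using (Fin; toℕ)
open import Data.Fin.Properties using (any?; all?) renaming (_≟_ to _≟ᶠ_)
open import Data.List using (List; []; _∷_; _++_; map; filter; length)
open import Data.List.Membership.Propositional using (_∈_; find; lose)
open import Data.List.Membership.Propositional.Properties using (∈-++⁺ˡ; ∈-++⁺ʳ; ∈-map⁺; ∈-map⁻)
import Data.List.Relation.Unary.All as All
import Data.List.Relation.Unary.Any as Any
open import Data.List.Relation.Unary.AllPairs using ([]; _∷_)
open import Data.List.Relation.Unary.Unique.Propositional using (Unique)
import Data.List.Relation.Unary.Unique.Propositional.Properties as Uniqueₚ
open import Data.Nat using (ℕ; zero; suc; _+_; _*_; _<_)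
open import Data.Nat.ListAction using (sum)
open import Data.Nat.Properties using (allUpTo?)
open import Data.Product using (∃; _×_; _,_)
open import Data.Sum using (_⊎_; inj₁; inj₂)
import Data.Sum.Properties as Sumₚ
open import Data.Vec using (Vec; []; _∷_; lookup)
import Data.Vec.Properties as Vecₚ
open import Function.Bundles using (_⤖_; _⇔_; Bijection)
open import Function.Definitions using (Injective)
open import Relation.Binary.Definitions using (Decidable; DecidableEquality; Symmetric; Irreflexive)
open import Relation.Binary.PropositionalEquality using (_≡_; _≢_; refl; sym)
open import Relation.Nullary using (Dec; no; ¬_)
open import Relation.Nullary.Decidable using (map′; ¬?; _×-dec_; _→-dec_)

record Graph : Set₁ where
  field
    V        : Set
    _≟_      : DecidableEquality V
    vertices : List V
    unique   : Unique vertices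
    complete : ∀ x → x ∈ vertices
    Adj      : V → V → Set
    adj?     : Decidable Adj
    adj-sym  : Symmetric Adj
    adj-irr  : Irreflexive _≡_ Adj

  order : ℕ
  order = length vertices

  Walk : ℕ → V → V → Set
  Walk zero    x y = x ≡ y
  Walk (suc k) x y = ∃ λ z → Adj x z × Walk k z y

  walk? : ∀ k → Decidable (Walk k)
  walk? zero    x y = x ≟ y
  walk? (suc k) x y =
    map′ (λ p → let (z , _ , q) = find p in z , q)
         (λ (z , q) → lose (complete z) q)
         (Any.any? (λ z → adj? x z ×-dec walk? k z y) vertices)

  -- Distance x y d holds for no d when x and y lie in different components.
  Distance : V → V → ℕ → Set
  Distance x y d = Walk d x y × (∀ {k} → k < d → ¬ Walk k x y)

  distance? : ∀ x y d → Dec (Distance x y d)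
  distance? x y d = walk? d x y ×-dec allUpTo? (λ k → ¬? (walk? k x y)) d

  -- The set D of distances is given by the list of its elements.
  InNbhd : List ℕ → V → V → Set
  InNbhd D x y = ∃ λ d → d ∈ D × Distance x y d

  inNbhd? : ∀ D → Decidable (InNbhd D)
  inNbhd? D x y = map′ find (λ (_ , d∈D , q) → lose d∈D q) (Any.any? (distance? x y) D)

  nbhd : List ℕ → V → List V
  nbhd D x = filter (inNbhd? D x) vertices

  -- A bijection onto {1,…,N} is a bijection onto Fin N followed by i ↦ 1 + i.
  Labeling : Set
  Labeling = V ⤖ Fin order

  label : Labeling → V → ℕ
  label f x = suc (toℕ (Bijection.to f x))

  weight : List ℕ → Labeling → V → ℕ
  weight D f x = sum (map (label f) (nbhd D x))

open Graph

record IsAntimagicLabeling (G : Graph) (D : List ℕ) (α δ : ℕ) (f : Labeling G) : Set where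
  field
    δ-positive  : 0 < δ
    distinct    : Injective _≡_ _≡_ (weight G D f)
    progression : ∀ w → (∃ λ x → weight G D f x ≡ w) ⇔ (∃ λ i → i < order G × w ≡ α + i * δ)

DAntimagic : List ℕ → ℕ → ℕ → Graph → Set
DAntimagic D α δ G = ∃ (IsAntimagicLabeling G D α δ)

DistanceAntimagic : ℕ → ℕ → Graph → Set
DistanceAntimagic = DAntimagic (1 ∷ [])

ClosedDistanceAntimagic : ℕ → ℕ → Graph → Set
ClosedDistanceAntimagic = DAntimagic (0 ∷ 1 ∷ [])

DiffersInOne : ∀ {m} → Vec Bool m → Vec Bool m → Set
DiffersInOne x y =
  ∃ λ i → lookup x i ≢ lookup y i × (∀ j → j ≢ i → lookup x j ≡ lookup y j)

differsInOne? : ∀ {m} → Decidable (DiffersInOne {m})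
differsInOne? x y = any? λ i →
  ¬? (lookup x i ≟ᵇ lookup y i) ×-dec
  all? (λ j → ¬? (j ≟ᶠ i) →-dec (lookup x j ≟ᵇ lookup y j))

words : ∀ m → List (Vec Bool m)
words zero    = [] ∷ []
words (suc m) = map (false ∷_) (words m) ++ map (true ∷_) (words m)

words-unique : ∀ m → Unique (words m)
words-unique zero    = All.[] ∷ []
words-unique (suc m) = Uniqueₚ.++⁺
  (Uniqueₚ.map⁺ Vecₚ.∷-injectiveʳ (words-unique m))
  (Uniqueₚ.map⁺ Vecₚ.∷-injectiveʳ (words-unique m))
  λ (p , q) → disjoint (∈-map⁻ (false ∷_) p) (∈-map⁻ (true ∷_) q)
  where
  disjoint : ∀ {v} → (∃ λ x → x ∈ words m × v ≡ false ∷ x) →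
             (∃ λ y → y ∈ words m × v ≡ true ∷ y) → ⊥
  disjoint (_ , _ , refl) (_ , _ , ())

words-complete : ∀ {m} (x : Vec Bool m) → x ∈ words m
words-complete []          = Any.here refl
words-complete (false ∷ x) = ∈-++⁺ˡ (∈-map⁺ (false ∷_) (words-complete x))
words-complete (true  ∷ x) = ∈-++⁺ʳ _ (∈-map⁺ (true ∷_) (words-complete x))

Q : ℕ → Graph
Q m = record
  { V        = Vec Bool m
  ; _≟_      = Vecₚ.≡-dec _≟ᵇ_
  ; vertices = words m
  ; unique   = words-unique m
  ; complete = words-complete
  ; Adj      = DiffersInOne
  ; adj?     = differsInOne?
  ; adj-sym  = λ (i , p , q) → i , (λ e → p (sym e)) , λ j j≢i → sym (q j j≢i)
  ; adj-irr  = λ { refl (_ , p , _) → p refl }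
  }

module _ (G H : Graph) where

  data UnionAdj : V G ⊎ V H → V G ⊎ V H → Set where
    left  : ∀ {x y} → Adj G x y → UnionAdj (inj₁ x) (inj₁ y)
    right : ∀ {x y} → Adj H x y → UnionAdj (inj₂ x) (inj₂ y)

  unionAdj? : Decidable UnionAdj
  unionAdj? (inj₁ x) (inj₁ y) = map′ left (λ { (left p) → p }) (adj? G x y)
  unionAdj? (inj₁ x) (inj₂ y) = no λ ()
  unionAdj? (inj₂ x) (inj₁ y) = no λ ()
  unionAdj? (inj₂ x) (inj₂ y) = map′ right (λ { (right p) → p }) (adj? H x y)

  disjointUnion : Graph
  disjointUnion = record
    { V        = V G ⊎ V H
    ; _≟_      = Sumₚ.≡-dec (_≟_ G) (_≟_ H)
    ; vertices = map inj₁ (vertices G) ++ map inj₂ (vertices H)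
    ; unique   = Uniqueₚ.++⁺ (Uniqueₚ.map⁺ Sumₚ.inj₁-injective (unique G))
                             (Uniqueₚ.map⁺ Sumₚ.inj₂-injective (unique H))
                             λ (p , q) → disjoint (∈-map⁻ inj₁ p) (∈-map⁻ inj₂ q)
    ; complete = λ { (inj₁ x) → ∈-++⁺ˡ (∈-map⁺ inj₁ (complete G x))
                   ; (inj₂ y) → ∈-++⁺ʳ _ (∈-map⁺ inj₂ (complete H y)) }
    ; Adj      = UnionAdj
    ; adj?     = unionAdj?
    ; adj-sym  = λ { (left p) → left (adj-sym G p) ; (right p) → right (adj-sym H p) }
    ; adj-irr  = λ { refl (left p) → adj-irr G refl p ; refl (right p) → adj-irr H refl p }
    }
    where
    disjoint : ∀ {v} → (∃ λ x → x ∈ vertices G × v ≡ inj₁ x) →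
               (∃ λ y → y ∈ vertices H × v ≡ inj₂ y) → ⊥
    disjoint (_ , _ , refl) (_ , _ , ())

twoCopies : Graph → Graph
twoCopies G = disjointUnion G G

{-# OPTIONS --safe #-}

-- Identify the vertices of 2Q_{n-1} with F₂ⁿ, the first coordinate selecting the
-- copy, and label z by 1 plus the number whose binary digits are M z, where M is
-- an invertible matrix over F₂.  A digit given by a row γ ∷ a, of value v at z, has
-- value v at the neighbours of z along the zeros of a and ¬ v along its ones, so
-- its sum over the neighbours depends only on v and on the weight of a.  If every
-- row of M has weight h, where 2h = n (open neighbourhoods) or 2h = n + 1 (closed
-- ones), this sum is h − 1 plus one bit: v when γ = 1 and ¬ v when γ = 0.  Hence
-- the weight of z is a constant plus the number with binary digits M z + c, for a
-- fixed c, and these run over an interval.  As vectors of weight h span F₂ⁿ when h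
-- is odd, M exists for n ≡ 1, 2 (mod 4).
module Submission where

open import Defs
open import Data.Bool using (Bool; true; false; not; _∧_; _xor_; if_then_else_)
open import Data.Bool.Properties using (xor-assoc; xor-comm; xor-identityʳ; not-¬; ¬-not; not-involutive)
open import Data.Empty using (⊥-elim)
open import Data.Fin using (Fin; zero; suc; toℕ; fromℕ<; punchOut)
open import Data.Fin.Properties using (any?; toℕ-fromℕ<; toℕ-injective; toℕ<n; punchOut-injective; injective⇒≤) renaming (_≟_ to _≟ᶠ_)
open import Data.List using (List; []; _∷_; map; length; lookup)
open import Data.List.Membership.Propositional using (_∈_)
open import Data.List.Membership.Propositional.Properties using (∈-map⁺; ∈-map⁻; ∈-filter⁺; ∈-filter⁻; ∈-lookup)
open import Data.List.Membership.Propositional.Properties.WithK using (unique∧set⇒bag)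
open import Data.List.Properties using (length-map; length-++; map-∘; map-cong)
open import Data.List.Relation.Binary.BagAndSetEquality using (∼bag⇒↭)
open import Data.List.Relation.Binary.Permutation.Propositional using (_↭_)
import Data.List.Relation.Binary.Permutation.Propositional.Properties as ↭ₚ
import Data.List.Relation.Unary.All as Allᴸ
import Data.List.Relation.Unary.All.Properties as Allᴸₚ
open import Data.List.Relation.Unary.AllPairs using ([]; _∷_)
open import Data.List.Relation.Unary.Any using (here; there)
open import Data.List.Relation.Unary.Unique.Propositional using (Unique)
import Data.List.Relation.Unary.Unique.Propositional.Properties as Uniqueₚ
open import Data.Nat using (ℕ; zero; suc; _+_; _*_; _∸_; _^_; _/_; _%_; _<_; _≤_; z≤n; s≤s)
open import Data.Nat.DivMod using (m≡m%n+[m/n]*n; m*n/n≡m)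
open import Data.Nat.ListAction using (sum)
open import Data.Nat.ListAction.Properties using (sum-↭)
open import Data.Nat.Properties using (+-comm; +-assoc; +-suc; +-identityʳ; *-identityʳ; +-cancelˡ-≡; *-cancelˡ-≡; suc-injective; ≤-trans; ≤-reflexive; +-mono-≤; *-monoʳ-≤; 1+n≰n; m+n∸n≡m)
open import Data.Nat.Tactic.RingSolver using (solve-∀)
open import Data.Product using (∃; _×_; _,_; proj₁; proj₂)
open import Data.Sum using (_⊎_; inj₁; inj₂)
open import Data.Sum.Properties using (inj₁-injective; inj₂-injective)
open import Data.Vec as Vec using (Vec; []; _∷_; _++_; replicate; head; splitAt)
import Data.Vec.Properties as Vecₚ
open import Data.Vec.Relation.Unary.All as Allⱽ using (All; []; _∷_)
import Data.Vec.Relation.Unary.All.Properties as Allⱽₚ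
open import Function using (_∘_)
open import Function.Bundles using (_⇔_; mk⇔; Equivalence)
open import Function.Definitions using (Injective)
open import Relation.Binary.PropositionalEquality using (_≡_; _≢_; refl; sym; trans; cong; cong₂; subst; module ≡-Reasoning)
open import Relation.Nullary using (yes; no)

open Graph using (V; vertices; order; Adj; Labeling; label; weight; nbhd; InNbhd)

-- Finite counting and lists without repetition.

-- Pigeonhole: if `k` were missed, deleting it from the codomain by `punchOut` would leave an
-- injection of `Fin (suc n)` into `Fin n`.
injective⇒surjective : ∀ {n} {f : Fin n → Fin n} → Injective _≡_ _≡_ f → ∀ k → ∃ λ i → f i ≡ k
injective⇒surjective {suc n} {f} inj k with any? (λ i → f i ≟ᶠ k)
... | yes hit  = hit
... | no  miss = ⊥-elim (1+n≰n (injective⇒≤ {f = λ i → punchOut (k≢ i)}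
                   (λ {i} {j} e → inj (punchOut-injective (k≢ i) (k≢ j) e))))
  where
  k≢ : ∀ i → k ≢ f i
  k≢ i e = miss (i , sym e)

unique⇒lookup-injective : ∀ {A : Set} {xs : List A} → Unique xs → Injective _≡_ _≡_ (lookup xs)
unique⇒lookup-injective (_ ∷ _) {zero}  {zero}  _ = refl
unique⇒lookup-injective (p ∷ _) {zero}  {suc j} e = ⊥-elim (Allᴸ.lookup p (∈-lookup j) e)
unique⇒lookup-injective (p ∷ _) {suc i} {zero}  e = ⊥-elim (Allᴸ.lookup p (∈-lookup i) (sym e))
unique⇒lookup-injective (_ ∷ u) {suc i} {suc j} e = cong suc (unique⇒lookup-injective u e)

-- Without repetitions an element lies in a list in at most one way, so equality as sets is already
-- equality as bags, which is a permutation.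
unique-set-↭ : ∀ {A : Set} {xs ys : List A} → Unique xs → Unique ys →
               (∀ {z} → z ∈ xs → z ∈ ys) → (∀ {z} → z ∈ ys → z ∈ xs) → xs ↭ ys
unique-set-↭ uxs uys to from = ∼bag⇒↭ (unique∧set⇒bag uxs uys (mk⇔ to from))

-- Antimagic labelings from injective functions

module _ (G : Graph) where

  private N = order G

  -- Enumerating the vertices by position turns `F` into an injective self-map of `Fin N`. This
  -- serves twice: for the labels and for the weights.
  injective⇒onto : (F : V G → ℕ) → Injective _≡_ _≡_ F → (∀ x → F x < N) →
                   ∀ {k} → k < N → ∃ λ x → F x ≡ k
  injective⇒onto F inj F<N {k} k<N =
    let i , e = injective⇒surjective f-injective (fromℕ< k<N)
    in  vertex i , trans (sym (toℕ-fromℕ< (F<N (vertex i)))) (trans (cong toℕ e) (toℕ-fromℕ< k<N))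
    where
    vertex : Fin N → V G
    vertex = lookup (vertices G)
    f : Fin N → Fin N
    f i = fromℕ< (F<N (vertex i))
    f-injective : Injective _≡_ _≡_ f
    f-injective {i} {j} e = unique⇒lookup-injective (Graph.unique G) (inj
      (trans (sym (toℕ-fromℕ< (F<N (vertex i)))) (trans (cong toℕ e) (toℕ-fromℕ< (F<N (vertex j))))))

  module _ (F : V G → ℕ) (F-injective : Injective _≡_ _≡_ F) (F<N : ∀ x → F x < N) where

    toLabeling : Labeling G
    toLabeling = record
      { to        = λ x → fromℕ< (F<N x)
      ; cong      = cong _
      ; bijective =
          (λ {x} {y} e → F-injective
            (trans (sym (toℕ-fromℕ< (F<N x))) (trans (cong toℕ e) (toℕ-fromℕ< (F<N y)))))
        , (λ k → let x , e = injective⇒onto F F-injective F<N (toℕ<n k)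
                 in  x , λ { refl → toℕ-injective (trans (toℕ-fromℕ< (F<N x)) e) })
      }

    label-toLabeling : ∀ x → label G toLabeling x ≡ suc (F x)
    label-toLabeling x = cong suc (toℕ-fromℕ< (F<N x))

    -- With difference 1 the offsets `W` have to run through all numbers below the order, so
    -- injectivity and the bound suffice, by the same counting that makes `F` a labeling.
    antimagic : ∀ D α (W : V G → ℕ) → Injective _≡_ _≡_ W → (∀ x → W x < N) →
                (∀ x → sum (map (suc ∘ F) (nbhd G D x)) ≡ α + W x) → DAntimagic D α 1 G
    antimagic D α W W-injective W<N weights = toLabeling , record
      { δ-positive  = s≤s z≤n
      ; distinct    = λ {x} {y} e → W-injective
          (+-cancelˡ-≡ α _ _ (trans (sym (weight≡ x)) (trans e (weight≡ y))))
      ; progression = λ w → mk⇔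
          (λ { (x , refl) → W x , W<N x , trans (weight≡ x) (cong (α +_) (sym (*-identityʳ (W x)))) })
          (λ { (i , i<N , refl) →
               let x , e = injective⇒onto W W-injective W<N i<N
               in  x , trans (weight≡ x) (cong (α +_) (trans e (sym (*-identityʳ i)))) })
      }
      where
      weight≡ : ∀ x → weight G D toLabeling x ≡ α + W x
      weight≡ x = trans (cong sum (map-cong label-toLabeling (nbhd G D x))) (weights x)

  -- Replaces the neighbourhood filtered out of all vertices by an explicit list, whose order may
  -- differ; the sum does not see the order.
  sum-nbhd : ∀ D x (g : V G → ℕ) {S} → Unique S → (∀ {y} → y ∈ S ⇔ InNbhd G D x y) →
             sum (map g (nbhd G D x)) ≡ sum (map g S)
  sum-nbhd D x g uS S⇔ = sum-↭ (↭ₚ.map⁺ g (unique-set-↭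
    (Uniqueₚ.filter⁺ (Graph.inNbhd? G D x) (Graph.unique G)) uS
    (λ p → Equivalence.from S⇔ (proj₂ (∈-filter⁻ (Graph.inNbhd? G D x) {xs = vertices G} p)))
    (λ p → ∈-filter⁺ (Graph.inNbhd? G D x) (Graph.complete G _) (Equivalence.to S⇔ p))))

  distance-one : ∀ {x y} → Adj G x y → Graph.Distance G x y 1
  distance-one a = (_ , a , refl) , λ { {zero} _ e → Graph.adj-irr G e a ; {suc _} (s≤s ()) }

  inNbhd-one : ∀ {x y} → Adj G x y ⇔ InNbhd G (1 ∷ []) x y
  inNbhd-one = mk⇔ (λ a → 1 , here refl , distance-one a)
                   (λ { (_ , here refl , (_ , a , refl) , _) → a })

  inNbhd-zero-one : ∀ {x y} → (y ≡ x ⊎ Adj G x y) ⇔ InNbhd G (0 ∷ 1 ∷ []) x y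
  inNbhd-zero-one = mk⇔
    (λ { (inj₁ refl) → 0 , here refl , refl , λ ()
       ; (inj₂ a)    → 1 , there (here refl) , distance-one a })
    (λ { (_ , here refl , refl , _)                      → inj₁ refl
       ; (_ , there (here refl) , (_ , a , refl) , _) → inj₂ a })

-- Neighbours in the hypercube

flips : ∀ {m} → Vec Bool m → List (Vec Bool m)
flips []      = []
flips (b ∷ v) = (not b ∷ v) ∷ map (b ∷_) (flips v)

length-flips : ∀ {m} (v : Vec Bool m) → length (flips v) ≡ m
length-flips []      = refl
length-flips (b ∷ v) = cong suc (trans (length-map (b ∷_) (flips v)) (length-flips v))

-- Only the first entry changes the head, so it differs from all the others.
flips-unique : ∀ {m} (v : Vec Bool m) → Unique (flips v)
flips-unique []      = []
flips-unique (b ∷ v) =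
  Allᴸₚ.map⁺ (Allᴸ.universal (λ _ e → not-¬ refl (sym (Vecₚ.∷-injectiveˡ e))) (flips v))
  ∷ Uniqueₚ.map⁺ Vecₚ.∷-injectiveʳ (flips-unique v)

flips⇒adj : ∀ {m} {v y : Vec Bool m} → y ∈ flips v → DiffersInOne v y
flips⇒adj {v = b ∷ v} (here refl) =
  zero , not-¬ refl , λ { zero 0≢0 → ⊥-elim (0≢0 refl) ; (suc j) _ → refl }
flips⇒adj {v = b ∷ v} (there p) with ∈-map⁻ (b ∷_) p
... | y , y∈ , refl with flips⇒adj y∈
...   | i , ≢i , ≡j = suc i , ≢i , λ { zero _ → refl ; (suc j) j≢i → ≡j j (j≢i ∘ cong suc) }

lookup-ext : ∀ {A : Set} {m} (u v : Vec A m) → (∀ i → Vec.lookup u i ≡ Vec.lookup v i) → u ≡ v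
lookup-ext []      []      _ = refl
lookup-ext (a ∷ u) (b ∷ v) h = cong₂ _∷_ (h zero) (lookup-ext u v (h ∘ suc))

adj⇒flips : ∀ {m} {v y : Vec Bool m} → DiffersInOne v y → y ∈ flips v
adj⇒flips {v = b ∷ v} {c ∷ y} (zero , b≢c , same) =
  here (cong₂ _∷_ (trans (sym (not-involutive c)) (cong not (sym (¬-not b≢c))))
                  (sym (lookup-ext v y (λ j → same (suc j) λ ()))))
adj⇒flips {v = b ∷ v} {c ∷ y} (suc i , ≢i , same) with same zero (λ ())
... | refl = there (∈-map⁺ (b ∷_) (adj⇒flips (i , ≢i , λ j j≢i → same (suc j) (j≢i ∘ λ { refl → refl }))))

-- Linear forms over F₂

bit : Bool → ℕ
bit b = if b then 1 else 0

-- The least significant digit comes first.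
val : ∀ {n} → Vec Bool n → ℕ
val []      = 0
val (b ∷ v) = bit b + 2 * val v

-- The Hamming weight, as opposed to the `weight` of a vertex under a labeling.
weightᵛ : ∀ {n} → Vec Bool n → ℕ
weightᵛ []      = 0
weightᵛ (b ∷ v) = bit b + weightᵛ v

dot : ∀ {n} → Vec Bool n → Vec Bool n → Bool
dot []      []      = false
dot (a ∷ r) (b ∷ v) = (a ∧ b) xor dot r v

_·_ : ∀ {n k} → Vec (Vec Bool n) k → Vec Bool n → Vec Bool k
M · z = Vec.map (λ r → dot r z) M

bit≤1 : ∀ b → bit b ≤ 1
bit≤1 false = z≤n
bit≤1 true  = s≤s z≤n

val<2^n : ∀ {n} (v : Vec Bool n) → val v < 2 ^ n
val<2^n         []      = s≤s z≤n
val<2^n {suc n} (b ∷ v) = ≤-trans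
  (s≤s (+-mono-≤ (bit≤1 b) (≤-reflexive refl)))
  (≤-trans (≤-reflexive (double (val v))) (*-monoʳ-≤ 2 (val<2^n v)))
  where
  double : ∀ k → 2 + 2 * k ≡ 2 * suc k
  double = solve-∀

-- The first digit is the parity of the value; once it is removed, halving leaves the value of the
-- remaining digits.
val-injective : ∀ {n} → Injective _≡_ _≡_ (val {n})
val-injective {x = []}    {[]}    _ = refl
val-injective {x = a ∷ u} {b ∷ v} e with digits a b (val u) (val v) e
  where
  even≢odd : ∀ k l → 2 * k ≢ suc (2 * l)
  even≢odd (suc k) zero    e with trans (sym (+-suc k (k + 0))) (suc-injective e)
  ... | ()
  even≢odd (suc k) (suc l) e = even≢odd k l
    (suc-injective (trans (sym (+-suc k (k + 0))) (trans (suc-injective e) (cong suc (+-suc l (l + 0))))))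
  digits : ∀ a b k l → bit a + 2 * k ≡ bit b + 2 * l → a ≡ b × k ≡ l
  digits false false k l e = refl , *-cancelˡ-≡ k l 2 e
  digits false true  k l e = ⊥-elim (even≢odd k l e)
  digits true  false k l e = ⊥-elim (even≢odd l k (sym e))
  digits true  true  k l e = refl , *-cancelˡ-≡ k l 2 (suc-injective e)
... | refl , e′ = cong (a ∷_) (val-injective e′)

suc-val-true : ∀ n → suc (val (replicate n true)) ≡ 2 ^ n
suc-val-true zero    = refl
suc-val-true (suc n) = trans (step (val (replicate n true))) (cong (2 *_) (suc-val-true n))
  where
  step : ∀ k → suc (1 + 2 * k) ≡ 2 * suc k
  step = solve-∀

xor-cancelˡ : ∀ a {b c} → a xor b ≡ a xor c → b ≡ c
xor-cancelˡ false         e = e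
xor-cancelˡ true {b} {c} e = trans (sym (not-involutive b)) (trans (cong not e) (not-involutive c))

xor-cancelʳ : ∀ a {b c} → b xor a ≡ c xor a → b ≡ c
xor-cancelʳ a {b} {c} e = xor-cancelˡ a (trans (xor-comm a b) (trans e (xor-comm c a)))

sum-map-+ : ∀ {A : Set} (f g : A → ℕ) xs →
            sum (map (λ x → f x + g x) xs) ≡ sum (map f xs) + sum (map g xs)
sum-map-+ f g []       = refl
sum-map-+ f g (x ∷ xs) = trans (cong (f x + g x +_) (sum-map-+ f g xs)) (shuffle (f x) (g x) _ _)
  where
  shuffle : ∀ a b c d → a + b + (c + d) ≡ a + c + (b + d)
  shuffle = solve-∀

sum-map-2* : ∀ {A : Set} (f : A → ℕ) xs → sum (map (λ x → 2 * f x) xs) ≡ 2 * sum (map f xs)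
sum-map-2* f []       = refl
sum-map-2* f (x ∷ xs) = trans (cong (2 * f x +_) (sum-map-2* f xs)) (distrib (f x) _)
  where
  distrib : ∀ a b → 2 * a + 2 * b ≡ 2 * (a + b)
  distrib = solve-∀

sum-map-suc : ∀ {A : Set} (f : A → ℕ) xs → sum (map (suc ∘ f) xs) ≡ length xs + sum (map f xs)
sum-map-suc f []       = refl
sum-map-suc f (x ∷ xs) = cong suc (trans (cong (f x +_) (sum-map-suc f xs)) (swap (f x) (length xs) (sum (map f xs))))
  where
  swap : ∀ a b c → a + (b + c) ≡ b + (a + c)
  swap = solve-∀

sum-map-0 : ∀ {A : Set} (xs : List A) → sum (map (λ _ → 0) xs) ≡ 0
sum-map-0 []       = refl
sum-map-0 (_ ∷ xs) = sum-map-0 xs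

-- Exchanges summation over `S` with summation over the digits. Every place contributes the same
-- `g`, in total `g` times the all-ones number, and one further bit; these bits are the digits of a
-- new number, so no carries have to be followed.
sum-val : ∀ {n k} (M : Vec (Vec Bool n) k) (g : ℕ) (φ : Vec Bool n → Bool) (S : List (Vec Bool n)) →
          All (λ r → sum (map (bit ∘ dot r) S) ≡ g + bit (φ r)) M →
          sum (map (λ z → val (M · z)) S) ≡ g * val (replicate k true) + val (Vec.map φ M)
sum-val []      g φ S []       = trans (sum-map-0 S) (base g)
  where
  base : ∀ g → 0 ≡ g * 0 + 0
  base = solve-∀
sum-val {k = suc k} (r ∷ M) g φ S (p ∷ ps) = begin
  sum (map (λ z → bit (dot r z) + 2 * val (M · z)) S)
    ≡⟨ sum-map-+ (bit ∘ dot r) (λ z → 2 * val (M · z)) S ⟩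
  sum (map (bit ∘ dot r) S) + sum (map (λ z → 2 * val (M · z)) S)
    ≡⟨ cong₂ _+_ p (trans (sum-map-2* (λ z → val (M · z)) S) (cong (2 *_) (sum-val M g φ S ps))) ⟩
  g + bit (φ r) + 2 * (g * val (replicate k true) + val (Vec.map φ M))
    ≡⟨ collect g (bit (φ r)) _ _ ⟩
  g * (1 + 2 * val (replicate k true)) + (bit (φ r) + 2 * val (Vec.map φ M)) ∎
  where
  open ≡-Reasoning
  collect : ∀ g b o w → g + b + 2 * (g * o + w) ≡ g * (1 + 2 * o) + (b + 2 * w)
  collect = solve-∀

-- Sums of a linear form over the neighbours of a vertex.

zeros : ∀ {n} → Vec Bool n → ℕ
zeros []      = 0
zeros (b ∷ v) = bit (not b) + zeros v

weight+zeros : ∀ {n} (a : Vec Bool n) → weightᵛ a + zeros a ≡ n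
weight+zeros []          = refl
weight+zeros (true  ∷ a) = cong suc (weight+zeros a)
weight+zeros (false ∷ a) = trans (+-suc _ _) (cong suc (weight+zeros a))

-- Flipping a coordinate changes the value of the form exactly where `a` has a one. From value 1 the
-- flips along the zeros of `a` keep a one, from value 0 the flips along its ones create one. The
-- constant `c` absorbs the coordinates that the recursion has passed.
sum-flips : ∀ {m} c (a v : Vec Bool m) →
            sum (map (λ y → bit (c xor dot a y)) (flips v))
            ≡ (if c xor dot a v then zeros a else weightᵛ a)
sum-flips c []      []      with c xor false
... | true  = refl
... | false = refl
sum-flips c (α ∷ a) (b ∷ v) = begin
  bit (c xor ((α ∧ not b) xor dot a v)) + sum (map (λ y → bit (c xor dot (α ∷ a) y)) (map (b ∷_) (flips v)))
    ≡⟨ cong (bit (c xor ((α ∧ not b) xor dot a v)) +_) (trans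
         (cong sum (trans (sym (map-∘ (flips v)))
                          (map-cong (λ y → cong bit (sym (xor-assoc c (α ∧ b) (dot a y)))) (flips v))))
         (sum-flips (c xor (α ∧ b)) a v)) ⟩
  bit (c xor ((α ∧ not b) xor dot a v)) + (if (c xor (α ∧ b)) xor dot a v then zeros a else weightᵛ a)
    ≡⟨ step c α b (dot a v) ⟩
  (if c xor ((α ∧ b) xor dot a v) then zeros (α ∷ a) else weightᵛ (α ∷ a)) ∎
  where
  open ≡-Reasoning
  step : ∀ c α b d →
         bit (c xor ((α ∧ not b) xor d)) + (if (c xor (α ∧ b)) xor d then zeros a else weightᵛ a)
         ≡ (if c xor ((α ∧ b) xor d) then zeros (α ∷ a) else weightᵛ (α ∷ a))
  step false false b     false = refl
  step false false b     true  = refl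
  step true  false b     false = refl
  step true  false b     true  = refl
  step false true  false false = refl
  step false true  false true  = refl
  step false true  true  false = refl
  step false true  true  true  = refl
  step true  true  false false = refl
  step true  true  false true  = refl
  step true  true  true  false = refl
  step true  true  true  true  = refl

-- e counts how often the centre itself occurs in its neighbourhood.
digit-sum : ∀ e g {m} c (r : Vec Bool (suc m)) (v : Vec Bool m) →
            weightᵛ r ≡ suc g → suc g + suc g ≡ suc m + e →
            e * bit (dot r (c ∷ v)) + sum (map (bit ∘ dot r) (map (c ∷_) (flips v)))
            ≡ g + bit (not (head r) xor dot r (c ∷ v))
digit-sum e g {m} c (γ ∷ a) v w≡ 2h≡ = trans
  (cong (e * bit ((γ ∧ c) xor dot a v) +_)
        (trans (cong sum (sym (map-∘ (flips v)))) (sum-flips (γ ∧ c) a v)))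
  (cases γ ((γ ∧ c) xor dot a v) w≡)
  where
  open ≡-Reasoning
  e*0+k≡k : ∀ e k → e * 0 + k ≡ k
  e*0+k≡k = solve-∀
  regroup : ∀ k e l → suc k + (e * 1 + l) ≡ suc (k + l) + e
  regroup = solve-∀
  -- If the form is 1 at the centre, the ones counted are the zeros of `a` and the `e` copies of the
  -- centre. Together with `suc (weightᵛ a)` they make up twice the weight of `r`, so in the last
  -- two cases they are found by cancellation.
  1-valued : suc (weightᵛ a) + (e * 1 + zeros a) ≡ suc g + suc g
  1-valued = begin
    suc (weightᵛ a) + (e * 1 + zeros a)  ≡⟨ regroup (weightᵛ a) e (zeros a) ⟩
    suc (weightᵛ a + zeros a) + e        ≡⟨ cong (λ t → suc t + e) (weight+zeros a) ⟩
    suc m + e                            ≡⟨ 2h≡ ⟨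
    suc g + suc g                        ∎
  cases : ∀ γ d → bit γ + weightᵛ a ≡ suc g →
          e * bit d + (if d then zeros a else weightᵛ a) ≡ g + bit (not γ xor d)
  cases true  false w = trans (e*0+k≡k e (weightᵛ a)) (trans (suc-injective w) (sym (+-identityʳ g)))
  cases false false w = trans (e*0+k≡k e (weightᵛ a)) (trans w (+-comm 1 g))
  cases true  true  w = +-cancelˡ-≡ (suc (weightᵛ a)) _ _ (begin
    suc (weightᵛ a) + (e * 1 + zeros a)  ≡⟨ 1-valued ⟩
    suc g + suc g                        ≡⟨ cong₂ _+_ (sym w) (+-comm 1 g) ⟩
    suc (weightᵛ a) + (g + 1)            ∎)
  cases false true  w = +-cancelˡ-≡ (suc (weightᵛ a)) _ _ (begin
    suc (weightᵛ a) + (e * 1 + zeros a)  ≡⟨ 1-valued ⟩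
    suc g + suc g                        ≡⟨ +-suc (suc g) g ⟩
    suc (suc g) + g                      ≡⟨ cong₂ (λ s t → suc s + t) (sym w) (sym (+-identityʳ g)) ⟩
    suc (weightᵛ a) + (g + 0)            ∎)

-- Two copies of the hypercube

length-words : ∀ m → length (words m) ≡ 2 ^ m
length-words zero    = refl
length-words (suc m) = begin
  length (words (suc m))
    ≡⟨ length-++ (map (false ∷_) (words m)) ⟩
  length (map (false ∷_) (words m)) + length (map (true ∷_) (words m))
    ≡⟨ cong₂ _+_ (trans (length-map _ (words m)) (length-words m))
                 (trans (length-map _ (words m)) (trans (length-words m) (sym (+-identityʳ _)))) ⟩
  2 ^ suc m ∎
  where open ≡-Reasoning

order-2Q : ∀ m → order (twoCopies (Q m)) ≡ 2 ^ suc m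
order-2Q m = begin
  order (twoCopies (Q m))
    ≡⟨ length-++ (map inj₁ (words m)) ⟩
  length (map {B = Vec Bool m ⊎ Vec Bool m} inj₁ (words m))
    + length (map {B = Vec Bool m ⊎ Vec Bool m} inj₂ (words m))
    ≡⟨ cong₂ _+_ (trans (length-map _ (words m)) (length-words m))
                 (trans (length-map _ (words m)) (trans (length-words m) (sym (+-identityʳ _)))) ⟩
  2 ^ suc m ∎
  where open ≡-Reasoning

module _ {m : ℕ} where

  private
    G = twoCopies (Q m)

  encode : V G → Vec Bool (suc m)
  encode (inj₁ v) = false ∷ v
  encode (inj₂ v) = true ∷ v

  encode-injective : Injective _≡_ _≡_ encode
  encode-injective {inj₁ _} {inj₁ _} refl = refl
  encode-injective {inj₁ _} {inj₂ _} ()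
  encode-injective {inj₂ _} {inj₁ _} ()
  encode-injective {inj₂ _} {inj₂ _} refl = refl

  neighbours : V G → List (V G)
  neighbours (inj₁ v) = map inj₁ (flips v)
  neighbours (inj₂ v) = map inj₂ (flips v)

  neighbours-unique : ∀ x → Unique (neighbours x)
  neighbours-unique (inj₁ v) = Uniqueₚ.map⁺ inj₁-injective (flips-unique v)
  neighbours-unique (inj₂ v) = Uniqueₚ.map⁺ inj₂-injective (flips-unique v)

  length-neighbours : ∀ x → length (neighbours x) ≡ m
  length-neighbours (inj₁ v) = trans (length-map inj₁ (flips v)) (length-flips v)
  length-neighbours (inj₂ v) = trans (length-map inj₂ (flips v)) (length-flips v)

  ∈-neighbours⁻ : ∀ x {y} → y ∈ neighbours x → Adj G x y
  ∈-neighbours⁻ (inj₁ v) p with ∈-map⁻ inj₁ p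
  ... | _ , q , refl = left (flips⇒adj q)
  ∈-neighbours⁻ (inj₂ v) p with ∈-map⁻ inj₂ p
  ... | _ , q , refl = right (flips⇒adj q)

  ∈-neighbours⁺ : ∀ {x y} → Adj G x y → y ∈ neighbours x
  ∈-neighbours⁺ (left a)  = ∈-map⁺ inj₁ (adj⇒flips a)
  ∈-neighbours⁺ (right a) = ∈-map⁺ inj₂ (adj⇒flips a)

  -- Edges stay inside a copy: the first coordinate is kept and one of the others is flipped. This
  -- is the shape to which `digit-sum` applies.
  encode-neighbours : ∀ x → map encode (neighbours x)
                          ≡ map (head (encode x) ∷_) (flips (Vec.tail (encode x)))
  encode-neighbours (inj₁ v) = sym (map-∘ (flips v))
  encode-neighbours (inj₂ v) = sym (map-∘ (flips v))

-- Labelings from bases of constant Hamming weight.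

-- A square matrix that is injective on a finite space is invertible, so its rows form a basis.
-- Injectivity is the form in which this enters the labels.
WeightBasis : ℕ → ℕ → Set
WeightBasis n h = ∃ λ (M : Vec (Vec Bool n) n) → All (λ r → weightᵛ r ≡ h) M × Injective _≡_ _≡_ (M ·_)

-- Translation by the fixed vector with entry `c r` at row `r` can be undone. It passes injectivity
-- from the labels to the weights, whose digits are those of the labels translated by
-- `not (head r)`.
map-xor-injective : ∀ {A : Set} {n} (c f g : A → Bool) (M : Vec A n) →
                    Vec.map (λ r → c r xor f r) M ≡ Vec.map (λ r → c r xor g r) M → Vec.map f M ≡ Vec.map g M
map-xor-injective c f g []      _ = refl
map-xor-injective c f g (r ∷ M) e =
  cong₂ _∷_ (xor-cancelˡ (c r) (Vecₚ.∷-injectiveˡ e)) (map-xor-injective c f g M (Vecₚ.∷-injectiveʳ e))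

module _ {m g : ℕ} (basis : WeightBasis (suc m) (suc g)) where

  private
    G = twoCopies (Q m)
    M = proj₁ basis
    rows = proj₁ (proj₂ basis)

    M-injective : Injective _≡_ _≡_ (M ·_)
    M-injective = proj₂ (proj₂ basis)

    F W : V G → ℕ
    F x = val (M · encode x)
    W x = val (Vec.map (λ r → not (head r) xor dot r (encode x)) M)

    val<order : (u : Vec Bool (suc m)) → val u < order G
    val<order u = subst (val u <_) (sym (order-2Q m)) (val<2^n u)

    F<order : ∀ x → F x < order G
    F<order x = val<order (M · encode x)

    W<order : ∀ x → W x < order G
    W<order x = val<order (Vec.map (λ r → not (head r) xor dot r (encode x)) M)

    F-injective : Injective _≡_ _≡_ F
    F-injective = encode-injective ∘ M-injective ∘ val-injective

    W-injective : Injective _≡_ _≡_ W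
    W-injective {x} {y} e = encode-injective (M-injective
      (map-xor-injective (not ∘ head) (λ r → dot r (encode x)) (λ r → dot r (encode y)) M (val-injective e)))

    -- The 1 added in every label contributes `length S`; the rest comes from the digit sums. As `S`
    -- is arbitrary, open and closed neighbourhoods are treated together.
    weights : ∀ D x S → Unique S → (∀ {y} → y ∈ S ⇔ InNbhd G D x y) →
              All (λ r → sum (map (bit ∘ dot r) (map encode S))
                         ≡ g + bit (not (head r) xor dot r (encode x))) M →
              sum (map (suc ∘ F) (nbhd G D x)) ≡ length S + g * val (replicate (suc m) true) + W x
    weights D x S uS S⇔ sums = begin
      sum (map (suc ∘ F) (nbhd G D x))  ≡⟨ sum-nbhd G D x (suc ∘ F) uS S⇔ ⟩
      sum (map (suc ∘ F) S)             ≡⟨ sum-map-suc F S ⟩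
      length S + sum (map F S)          ≡⟨ cong (λ l → length S + sum l) (map-∘ S) ⟩
      length S + sum (map (λ z → val (M · z)) (map encode S))
        ≡⟨ cong (length S +_) (sum-val M g _ (map encode S) sums) ⟩
      length S + (g * val (replicate (suc m) true) + W x)
        ≡⟨ +-assoc (length S) _ _ ⟨
      length S + g * val (replicate (suc m) true) + W x ∎
      where open ≡-Reasoning

    digit-sum-neighbours : ∀ e → suc g + suc g ≡ suc m + e → ∀ x r → weightᵛ r ≡ suc g →
      e * bit (dot r (encode x)) + sum (map (bit ∘ dot r) (map encode (neighbours x)))
      ≡ g + bit (not (head r) xor dot r (encode x))
    digit-sum-neighbours e 2h≡ x r w rewrite encode-neighbours x with encode x
    ... | c ∷ v = digit-sum e g c r v w 2h≡

  distanceAntimagic : suc g + suc g ≡ suc m →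
    DistanceAntimagic (m + g * val (replicate (suc m) true)) 1 (twoCopies (Q m))
  distanceAntimagic 2h≡ = antimagic G F F-injective F<order (1 ∷ []) _ W W-injective W<order λ x →
    trans (weights (1 ∷ []) x (neighbours x) (neighbours-unique x)
            (mk⇔ (Equivalence.to (inNbhd-one G) ∘ ∈-neighbours⁻ x)
                 (∈-neighbours⁺ ∘ Equivalence.from (inNbhd-one G)))
            -- With `e` = 0 the term of the centre vanishes by computation.
            (Allⱽ.map (λ {r} → digit-sum-neighbours 0 (trans 2h≡ (sym (+-identityʳ _))) x r) rows))
          (cong (λ l → l + g * val (replicate (suc m) true) + W x) (length-neighbours x))

  closedDistanceAntimagic : suc g + suc g ≡ suc m + 1 →
    ClosedDistanceAntimagic (suc m + g * val (replicate (suc m) true)) 1 (twoCopies (Q m))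
  closedDistanceAntimagic 2h≡ = antimagic G F F-injective F<order (0 ∷ 1 ∷ []) _ W W-injective W<order λ x →
    trans (weights (0 ∷ 1 ∷ []) x (x ∷ neighbours x)
            -- The centre is not among its neighbours, since adjacency is irreflexive.
            (Allᴸ.tabulate (λ p e → Graph.adj-irr G e (∈-neighbours⁻ x p)) ∷ neighbours-unique x)
            (mk⇔ (λ { (here refl) → Equivalence.to (inNbhd-zero-one G) (inj₁ refl)
                    ; (there p)   → Equivalence.to (inNbhd-zero-one G) (inj₂ (∈-neighbours⁻ x p)) })
                 (λ p → member (Equivalence.from (inNbhd-zero-one G) p)))
            -- With `e` = 1 the term of the centre computes to its bit plus 0, whereas the head of
            -- the list contributes the bit alone.
            (Allⱽ.map (λ {r} w → trans (cong (_+ sum (map (bit ∘ dot r) (map encode (neighbours x))))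
                                             (sym (+-identityʳ _)))
                                       (digit-sum-neighbours 1 2h≡ x r w)) rows))
          (cong (λ l → suc l + g * val (replicate (suc m) true) + W x) (length-neighbours x))
    where
    member : ∀ {x y} → y ≡ x ⊎ Adj G x y → y ∈ x ∷ neighbours x
    member (inj₁ e) = here e
    member (inj₂ a) = there (∈-neighbours⁺ a)

-- Bases of odd weight

parity : ∀ {n} → Vec Bool n → Bool
parity {n} = dot (replicate n true)

-- The identity matrix and its entrywise complement, whose rows have all ones but one.
units counits : ∀ n → Vec (Vec Bool n) n
units zero    = []
units (suc n) = (true ∷ replicate n false) ∷ Vec.map (false ∷_) (units n)
counits zero    = []
counits (suc n) = (false ∷ replicate n true) ∷ Vec.map (true ∷_) (counits n)

dot-false : ∀ {n} (v : Vec Bool n) → dot (replicate n false) v ≡ false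
dot-false []      = refl
dot-false (_ ∷ v) = dot-false v

dot-++ : ∀ {m n} (r : Vec Bool m) (s : Vec Bool n) x y → dot (r ++ s) (x ++ y) ≡ dot r x xor dot s y
dot-++ []      s []      y = refl
dot-++ (a ∷ r) s (b ∷ x) y =
  trans (cong ((a ∧ b) xor_) (dot-++ r s x y)) (sym (xor-assoc (a ∧ b) (dot r x) (dot s y)))

units-· : ∀ {n} (v : Vec Bool n) → units n · v ≡ v
units-· []      = refl
units-· (b ∷ v) = cong₂ _∷_ (trans (cong (b xor_) (dot-false v)) (xor-identityʳ b))
                            (trans (sym (Vecₚ.map-∘ _ _ (units _))) (units-· v))

-- A row adds up all coordinates except one, which over F₂ is the parity plus that coordinate.
counits-· : ∀ {n} (v : Vec Bool n) → counits n · v ≡ Vec.map (parity v xor_) v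
counits-· []      = refl
counits-· (b ∷ v) = cong₂ _∷_
  (drop b (parity v))
  (trans (sym (Vecₚ.map-∘ _ _ (counits _)))
  (trans (Vecₚ.map-∘ (b xor_) (λ r → dot r v) (counits _))
  (trans (cong (Vec.map (b xor_)) (counits-· v))
  (trans (sym (Vecₚ.map-∘ _ _ v)) (Vecₚ.map-cong (λ t → sym (xor-assoc b (parity v) t)) v)))))
  where
  drop : ∀ b p → p ≡ (b xor p) xor b
  drop false false = refl
  drop false true  = refl
  drop true  false = refl
  drop true  true  = refl

-- The shift adds `c` an even number of times. This is where evenness of the block, and with it the
-- odd weight of the rows, enters.
parity-shift : ∀ j c (x : Vec Bool (j * 2)) → parity (Vec.map (c xor_) x) ≡ parity x
parity-shift zero    c []          = refl
parity-shift (suc j) c (a ∷ b ∷ x) =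
  trans (cong (λ p → (c xor a) xor ((c xor b) xor p)) (parity-shift j c x)) (cancel c a b (parity x))
  where
  cancel : ∀ c a b p → (c xor a) xor ((c xor b) xor p) ≡ a xor (b xor p)
  cancel false a     b     p = refl
  cancel true  false false p = not-involutive p
  cancel true  false true  p = refl
  cancel true  true  false p = refl
  cancel true  true  true  p = sym (not-involutive p)

weight-false : ∀ n → weightᵛ (replicate n false) ≡ 0
weight-false zero    = refl
weight-false (suc n) = weight-false n

weight-true : ∀ n → weightᵛ (replicate n true) ≡ n
weight-true zero    = refl
weight-true (suc n) = cong suc (weight-true n)

weight-++ : ∀ {m n} (r : Vec Bool m) (s : Vec Bool n) → weightᵛ (r ++ s) ≡ weightᵛ r + weightᵛ s
weight-++ []      s = refl
weight-++ (a ∷ r) s = trans (cong (bit a +_) (weight-++ r s)) (sym (+-assoc (bit a) _ _))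

weight-units : ∀ n → All (λ r → weightᵛ r ≡ 1) (units n)
weight-units zero    = []
weight-units (suc n) = cong suc (weight-false n) ∷ Allⱽₚ.map⁺ (weight-units n)

weight-counits : ∀ n → All (λ r → suc (weightᵛ r) ≡ n) (counits n)
weight-counits zero    = []
weight-counits (suc n) = cong suc (weight-true n) ∷ Allⱽₚ.map⁺ (Allⱽ.map (cong suc) (weight-counits n))

-- On a ∷ b ∷ x ++ y, with x of even length and parity p, the forms are a + p, b + p,
-- a + b + p + xᵢ and p + yᵢ.  The values a + b + p + xᵢ have parity p again, so p is
-- determined by them and everything else follows.
oddBasis : ∀ j k → WeightBasis (2 + (j * 2 + k)) (1 + j * 2)
oddBasis j k = M , rows , M-injective
  where
  open ≡-Reasoning
  l = j * 2
  𝟏 = replicate l true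
  𝟎 = replicate k false

  row₁ : Vec Bool l → Vec Bool (2 + (l + k))
  row₁ r = true ∷ true ∷ r ++ 𝟎

  row₂ : Vec Bool k → Vec Bool (2 + (l + k))
  row₂ r = false ∷ false ∷ 𝟏 ++ r

  M : Vec (Vec Bool (2 + (l + k))) (2 + (l + k))
  M = (true ∷ false ∷ 𝟏 ++ 𝟎) ∷ (false ∷ true ∷ 𝟏 ++ 𝟎)
      ∷ Vec.map row₁ (counits l) ++ Vec.map row₂ (units k)

  weight-++𝟎 : ∀ r → weightᵛ (r ++ 𝟎) ≡ weightᵛ r
  weight-++𝟎 r = trans (weight-++ r 𝟎) (trans (cong (weightᵛ r +_) (weight-false k)) (+-identityʳ _))

  rows : All (λ r → weightᵛ r ≡ 1 + l) M
  -- The weights are 1 + l for the first two rows, 2 + (l - 1) for those from `counits`, and l + 1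
  -- for those from `units`.
  rows = cong suc (trans (weight-++𝟎 𝟏) (weight-true l)) ∷ cong suc (trans (weight-++𝟎 𝟏) (weight-true l))
       ∷ Allⱽₚ.++⁺
           (Allⱽₚ.map⁺ (Allⱽ.map (λ {r} w → cong suc (trans (cong suc (weight-++𝟎 r)) w)) (weight-counits l)))
           (Allⱽₚ.map⁺ (Allⱽ.map (λ {r} w → trans (weight-++ 𝟏 r)
             (trans (cong₂ _+_ (weight-true l) w) (+-comm l 1))) (weight-units k)))

  dot-++𝟎 : ∀ r x y → dot (r ++ 𝟎) (x ++ y) ≡ dot r x
  dot-++𝟎 r x y = trans (dot-++ r 𝟎 x y) (trans (cong (dot r x xor_) (dot-false y)) (xor-identityʳ _))

  shift : Bool → Bool → Vec Bool l → Bool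
  shift a b x = (a xor b) xor parity x

  M-· : ∀ a b x y → M · (a ∷ b ∷ x ++ y)
        ≡ (a xor parity x) ∷ (b xor parity x) ∷ Vec.map (shift a b x xor_) x ++ Vec.map (parity x xor_) y
  M-· a b x y = cong₂ _∷_ (cong (a xor_) (dot-++𝟎 𝟏 x y)) (cong₂ _∷_ (cong (b xor_) (dot-++𝟎 𝟏 x y))
    (trans (Vecₚ.map-++ _ (Vec.map row₁ (counits l)) (Vec.map row₂ (units k))) (cong₂ _++_ upper lower)))
    where
    z = a ∷ b ∷ x ++ y
    p = parity x
    upper : Vec.map row₁ (counits l) · z ≡ Vec.map (shift a b x xor_) x
    upper = begin
      Vec.map row₁ (counits l) · z
        ≡⟨ Vecₚ.map-∘ _ row₁ (counits l) ⟨
      Vec.map (λ r → a xor (b xor dot (r ++ 𝟎) (x ++ y))) (counits l)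
        ≡⟨ Vecₚ.map-cong (λ r → trans (cong (λ t → a xor (b xor t)) (dot-++𝟎 r x y)) (sym (xor-assoc a b _))) (counits l) ⟩
      Vec.map (λ r → (a xor b) xor dot r x) (counits l)
        ≡⟨ Vecₚ.map-∘ ((a xor b) xor_) (λ r → dot r x) (counits l) ⟩
      Vec.map ((a xor b) xor_) (counits l · x)
        ≡⟨ cong (Vec.map ((a xor b) xor_)) (counits-· x) ⟩
      Vec.map ((a xor b) xor_) (Vec.map (p xor_) x)
        ≡⟨ Vecₚ.map-∘ _ _ x ⟨
      Vec.map (λ t → (a xor b) xor (p xor t)) x
        ≡⟨ Vecₚ.map-cong (λ t → sym (xor-assoc (a xor b) p t)) x ⟩
      Vec.map (shift a b x xor_) x ∎
    lower : Vec.map row₂ (units k) · z ≡ Vec.map (p xor_) y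
    lower = begin
      Vec.map row₂ (units k) · z
        ≡⟨ Vecₚ.map-∘ _ row₂ (units k) ⟨
      Vec.map (λ r → dot (𝟏 ++ r) (x ++ y)) (units k)
        ≡⟨ Vecₚ.map-cong (λ r → dot-++ 𝟏 r x y) (units k) ⟩
      Vec.map (λ r → p xor dot r y) (units k)
        ≡⟨ Vecₚ.map-∘ (p xor_) (λ r → dot r y) (units k) ⟩
      Vec.map (p xor_) (units k · y)
        ≡⟨ cong (Vec.map (p xor_)) (units-· y) ⟩
      Vec.map (p xor_) y ∎

  -- The two shifts are computed from different vectors, so their equality has to be supplied
  -- separately.
  map-xor-cancel : ∀ {n} c {c′} → c ≡ c′ → (u v : Vec Bool n) → Vec.map (c xor_) u ≡ Vec.map (c′ xor_) v → u ≡ v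
  map-xor-cancel c refl []      []      _ = refl
  map-xor-cancel c refl (s ∷ u) (t ∷ v) e =
    cong₂ _∷_ (xor-cancelˡ c (Vecₚ.∷-injectiveˡ e)) (map-xor-cancel c refl u v (Vecₚ.∷-injectiveʳ e))

  recover : ∀ a b x y a′ b′ x′ y′ →
            M · (a ∷ b ∷ x ++ y) ≡ M · (a′ ∷ b′ ∷ x′ ++ y′) → a ∷ b ∷ x ++ y ≡ a′ ∷ b′ ∷ x′ ++ y′
  recover a b x y a′ b′ x′ y′ e =
    cong₂ _∷_ a≡ (cong₂ _∷_ b≡ (cong₂ _++_ (map-xor-cancel (shift a b x) c≡ x x′ x-eq) (map-xor-cancel _ p≡ y y′ y-eq)))
    where
    eq   = trans (sym (M-· a b x y)) (trans e (M-· a′ b′ x′ y′))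
    tail = Vecₚ.∷-injectiveʳ (Vecₚ.∷-injectiveʳ eq)
    x-eq = Vecₚ.++-injectiveˡ (Vec.map (shift a b x xor_) x) (Vec.map (shift a′ b′ x′ xor_) x′) tail
    y-eq = Vecₚ.++-injectiveʳ (Vec.map (shift a b x xor_) x) (Vec.map (shift a′ b′ x′ xor_) x′) tail
    p≡ : parity x ≡ parity x′
    -- The parity is read off the third block while the shift applied to it is still unknown.
    p≡ = trans (sym (parity-shift j (shift a b x) x)) (trans (cong parity x-eq) (parity-shift j (shift a′ b′ x′) x′))
    a≡ : a ≡ a′
    a≡ = xor-cancelʳ (parity x) (trans (Vecₚ.∷-injectiveˡ eq) (cong (a′ xor_) (sym p≡)))
    b≡ : b ≡ b′
    b≡ = xor-cancelʳ (parity x) (trans (Vecₚ.∷-injectiveˡ (Vecₚ.∷-injectiveʳ eq)) (cong (b′ xor_) (sym p≡)))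
    c≡ : shift a b x ≡ shift a′ b′ x′
    c≡ = cong₂ _xor_ (cong₂ _xor_ a≡ b≡) p≡

  M-injective : Injective _≡_ _≡_ (M ·_)
  M-injective {a ∷ b ∷ z} {a′ ∷ b′ ∷ z′} e with splitAt l z | splitAt l z′
  ... | x , y , refl | x′ , y′ , refl = recover a b x y a′ b′ x′ y′ e

-- Choice of the sizes, start of the progression, and the theorem.

-- For rows of weight h = 1 + l in dimension n = 2 + l + k, the condition 2h = n means k = l, here
-- 2q.
basis-2+4q : ∀ q → WeightBasis (2 + q * 4) (1 + q * 2)
basis-2+4q q = subst (λ n → WeightBasis n (1 + q * 2)) (size q) (oddBasis q (q * 2))
  where
  size : ∀ q → 2 + (q * 2 + q * 2) ≡ 2 + q * 4
  size = solve-∀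

-- The condition 2h = n + 1 means k = l - 1. This cannot be met with l = 0, so n = 1 is treated
-- apart, by the matrix with single entry 1.
basis-1+4q : ∀ q → WeightBasis (1 + q * 4) (1 + q * 2)
basis-1+4q zero    = ((true ∷ []) ∷ []) , refl ∷ [] ,
  λ { {a ∷ []} {b ∷ []} e → cong (_∷ []) (xor-cancelʳ false (Vecₚ.∷-injectiveˡ e)) }
basis-1+4q (suc q) = subst (λ n → WeightBasis n (1 + suc q * 2)) (size q) (oddBasis (suc q) (1 + q * 2))
  where
  size : ∀ q → 2 + (suc q * 2 + (1 + q * 2)) ≡ 1 + suc q * 4
  size = solve-∀

-- Here `c` is the size of a neighbourhood and `t` = 2h with h = g + 1, so the division is exact.
-- With 2ⁿ = o + 1 the right side is (g + 1)(o + 2) - (o + 1) = (2g + 1) + g o, where the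
-- subtraction does not truncate.
progression-start : ∀ n g {c t} → c ≡ suc (g + g) → t ≡ suc g * 2 →
                    c + g * val (replicate n true) ≡ t * (2 ^ n + 1) / 2 ∸ 2 ^ n
progression-start n g refl refl = sym (begin
  suc g * 2 * (2 ^ n + 1) / 2 ∸ 2 ^ n
    ≡⟨ cong (λ N → N / 2 ∸ 2 ^ n) (factor g (2 ^ n)) ⟩
  suc g * (2 ^ n + 1) * 2 / 2 ∸ 2 ^ n
    ≡⟨ cong (_∸ 2 ^ n) (m*n/n≡m (suc g * (2 ^ n + 1)) 2) ⟩
  suc g * (2 ^ n + 1) ∸ 2 ^ n
    ≡⟨ cong (λ N → suc g * (N + 1) ∸ N) (suc-val-true n) ⟨
  suc g * (suc o + 1) ∸ suc o
    ≡⟨ cong (_∸ suc o) (split g o) ⟩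
  suc (g + g) + g * o + suc o ∸ suc o
    ≡⟨ m+n∸n≡m _ (suc o) ⟩
  suc (g + g) + g * o ∎)
  where
  open ≡-Reasoning
  o = val (replicate n true)
  factor : ∀ g N → suc g * 2 * (N + 1) ≡ suc g * (N + 1) * 2
  factor = solve-∀
  split : ∀ g o → suc g * (suc o + 1) ≡ suc (g + g) + g * o + suc o
  split = solve-∀

distanceAntimagic-2Q : ∀ q → let n = 2 + q * 4 in
  DistanceAntimagic (n * (2 ^ n + 1) / 2 ∸ 2 ^ n) 1 (twoCopies (Q (n ∸ 1)))
distanceAntimagic-2Q q =
  subst (λ α → DistanceAntimagic α 1 (twoCopies (Q (1 + q * 4))))
        (progression-start (2 + q * 4) (q * 2) (degree q) (size q))
        (distanceAntimagic (basis-2+4q q) (half q))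
  where
  degree : ∀ q → 1 + q * 4 ≡ suc (q * 2 + q * 2)
  degree = solve-∀
  size : ∀ q → 2 + q * 4 ≡ suc (q * 2) * 2
  size = solve-∀
  half : ∀ q → suc (q * 2) + suc (q * 2) ≡ 2 + q * 4
  half = solve-∀

closedDistanceAntimagic-2Q : ∀ q → let n = 1 + q * 4 in
  ClosedDistanceAntimagic ((n + 1) * (2 ^ n + 1) / 2 ∸ 2 ^ n) 1 (twoCopies (Q (n ∸ 1)))
closedDistanceAntimagic-2Q q =
  subst (λ α → ClosedDistanceAntimagic α 1 (twoCopies (Q (q * 4))))
        (progression-start (1 + q * 4) (q * 2) (degree q) (size q))
        (closedDistanceAntimagic (basis-1+4q q) (half q))
  where
  degree : ∀ q → 1 + q * 4 ≡ suc (q * 2 + q * 2)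
  degree = solve-∀
  size : ∀ q → 1 + q * 4 + 1 ≡ suc (q * 2) * 2
  size = solve-∀
  half : ∀ q → suc (q * 2) + suc (q * 2) ≡ 1 + q * 4 + 1
  half = solve-∀

theorem3p11 : (n : ℕ) →
    (n % 4 ≡ 2 → DistanceAntimagic (n * (2 ^ n + 1) / 2 ∸ 2 ^ n) 1 (twoCopies (Q (n ∸ 1))))
    × (n % 4 ≡ 1 → ClosedDistanceAntimagic ((n + 1) * (2 ^ n + 1) / 2 ∸ 2 ^ n) 1 (twoCopies (Q (n ∸ 1))))
theorem3p11 n =
    -- Both cases were proved for n written as a remainder plus 4q; division with remainder supplies
    -- q = `n / 4`.
    (λ n%4≡2 → subst (λ n → DistanceAntimagic (n * (2 ^ n + 1) / 2 ∸ 2 ^ n) 1 (twoCopies (Q (n ∸ 1))))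
                     (quotient n%4≡2) (distanceAntimagic-2Q (n / 4)))
  , (λ n%4≡1 → subst (λ n → ClosedDistanceAntimagic ((n + 1) * (2 ^ n + 1) / 2 ∸ 2 ^ n) 1 (twoCopies (Q (n ∸ 1))))
                     (quotient n%4≡1) (closedDistanceAntimagic-2Q (n / 4)))
  where
  quotient : ∀ {r} → n % 4 ≡ r → r + n / 4 * 4 ≡ n
  quotient refl = sym (m≡m%n+[m/n]*n n 4)
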